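{- Let $g,f\in\mathcal{F}_0$. Then $$\{g,f\}^{ -1}=\left\{\frac{1}{g\left(\operatorname{Rev}\left(\frac{x}{f}\right)\right)},\ \frac{x}{\operatorname{Rev}\left(\frac{x}{f}\right)}\right\}.$$
   Context: All power series are formal power series in $x$ with coefficients in $\mathbb{Q}$. $\mathcal{F}_0$ is the set of series $a_0+a_1x+a_2x^2+\cdots$ with $a_0\neq 0$; $\mathcal{F}_1$ is the set of series $a_1x+a_2x^2+\cdots$ with $a_1\ne 0$. $[x^m]$ extracts the coefficient of $x^m$ (and is $0$ for $m<0$). For $v\in\mathcal{F}_1$, $\operatorname{Rev}(v)\in\mathcal{F}_1$ denotes its compositional inverse. The quotient $x/w$ for $w\in\mathcal{F}_1$ is understood as a power series after cancelling the factor $x$. For $g,f\in\mathcal{F}_0$, $\{g,f\}$ denotes the infinite lower-triangular matrix, indexed by $n,k\ge0$, with $(n,k)$ entry $[x^{n-k}]\,g(x)f(x)^n$. The inverse is the matrix inverse. -}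

module Defs where

open import Data.Fin.Base using (Fin; toℕ)
import Data.Fin.Properties as Fin
open import Data.Integer.Base using (ℤ; -[1+_]; _⊖_) renaming (+_ to pos)
import Data.Integer.Properties as ℤ
open import Data.Nat.Base as ℕ using (ℕ; zero; suc; _∸_; _≤_; _<_; z≤n; s≤s)
import Data.Nat.Properties as ℕ
open import Data.Product.Base using (_×_)
open import Data.Rational.Base using (ℚ; 0ℚ; 1ℚ; _+_; _*_; _-_; 1/_; ≢-nonZero)
open import Data.Rational.Properties
open import Data.Rational.Solver using (module +-*-Solver)
open import Algebra.Bundles using (CommutativeRing)
open import Algebra.Properties.Semiring.Sum
  (CommutativeRing.semiring +-*-commutativeRing)
  using (sum; sum-syntax; sum⁺-syntax; sum-cong-≗; ∑-comm; ∑-distrib-+; *-distribˡ-sum)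
open import Relation.Binary.PropositionalEquality
open import Relation.Nullary.Negation.Core using (contradiction)

open +-*-Solver using (solve; _:=_; _:+_; _:*_; _:-_; con)
open ≡-Reasoning

infixl 6 _+ₛ_
infixl 7 _*ₛ_ _·_
infixr 8 _^ₛ_
infixr 9 _∘ₛ_
infix  4 _≈[_]_

Series : Set
Series = ℕ → ℚ

[x^_]_ : ℤ → Series → ℚ
[x^ pos m    ] a = a m
[x^ -[1+ _ ] ] a = 0ℚ

0ₛ 1ₛ X : Series
0ₛ _       = 0ℚ
1ₛ zero    = 1ℚ
1ₛ (suc _) = 0ℚ
X  zero    = 0ℚ
X  (suc n) = 1ₛ n

_+ₛ_ _*ₛ_ : Series → Series → Series
(a +ₛ b) n = a n + b n
(a *ₛ b) n = ∑[ i ≤ n ] (a (toℕ i) * b (n ∸ toℕ i))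

_^ₛ_ : Series → ℕ → Series
a ^ₛ zero  = 1ₛ
a ^ₛ suc k = a *ₛ a ^ₛ k

tail : Series → Series
tail a n = a (suc n)

-- The sum is the full ∑ₖ aₖ wᵏ only if w has zero constant term: then wᵏ has
-- no terms of degree < k.
_∘ₛ_ : Series → Series → Series
(a ∘ₛ w) n = ∑[ k ≤ n ] (a (toℕ k) * (w ^ₛ toℕ k) n)

record 𝓕₀ : Set where
  constructor mk𝓕₀
  field
    series : Series
    c₀≢0   : series 0 ≢ 0ℚ

record 𝓕₁ : Set where
  constructor mk𝓕₁
  field
    series : Series
    c₀≡0   : series 0 ≡ 0ℚ
    c₁≢0   : series 1 ≢ 0ℚ

inv : (p : ℚ) → p ≢ 0ℚ → ℚ
inv p p≢0 = (1/ p) {{≢-nonZero p≢0}}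

-- Forward substitution: the solution w of the infinite lower triangular
-- system  ∑_{k ≤ n} L n k · w k = b n,  computed by eliminating w 0 from all
-- later equations.
solveLT : (L : ℕ → ℕ → ℚ) → (∀ n → L n n ≢ 0ℚ) → Series → Series
solveLT L nz b zero    = inv (L 0 0) (nz 0) * b 0
solveLT L nz b (suc n) =
  solveLT (λ i j → L (suc i) (suc j)) (λ i → nz (suc i))
          (λ i → b (suc i) - L (suc i) 0 * (inv (L 0 0) (nz 0) * b 0)) n

inv-inverseʳ : ∀ p p≢0 → p * inv p p≢0 ≡ 1ℚ
inv-inverseʳ p p≢0 = *-inverseʳ p {{≢-nonZero p≢0}}

solveLT-correct : ∀ L nz b n →
                  ∑[ k ≤ n ] (L n (toℕ k) * solveLT L nz b (toℕ k)) ≡ b n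
solveLT-correct L nz b zero = begin
  L 0 0 * (inv (L 0 0) (nz 0) * b 0) + 0ℚ ≡⟨ +-identityʳ _ ⟩
  L 0 0 * (inv (L 0 0) (nz 0) * b 0)      ≡⟨ *-assoc (L 0 0) _ (b 0) ⟨
  L 0 0 * inv (L 0 0) (nz 0) * b 0        ≡⟨ cong (_* b 0) (inv-inverseʳ (L 0 0) (nz 0)) ⟩
  1ℚ * b 0                                ≡⟨ *-identityˡ (b 0) ⟩
  b 0                                     ∎
solveLT-correct L nz b (suc n) = begin
  c + _                   ≡⟨ cong (c +_) (solveLT-correct L′ nz′ b′ n) ⟩
  c + (b (suc n) - c)     ≡⟨ solve 2 (λ c b → c :+ (b :- c) := b) refl c (b (suc n)) ⟩
  b (suc n)               ∎
  where
  c : ℚ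
  c = L (suc n) 0 * (inv (L 0 0) (nz 0) * b 0)
  L′ = λ i j → L (suc i) (suc j)
  nz′ = λ i → nz (suc i)
  b′ = λ i → b (suc i) - L (suc i) 0 * (inv (L 0 0) (nz 0) * b 0)

*-≢0 : ∀ {p q} → p ≢ 0ℚ → q ≢ 0ℚ → p * q ≢ 0ℚ
*-≢0 {p} {q} p≢0 q≢0 pq≡0 = q≢0 (begin
  q                     ≡⟨ *-identityˡ q ⟨
  1ℚ * q                ≡⟨ cong (_* q) (inv-inverseʳ p p≢0) ⟨
  p * inv p p≢0 * q     ≡⟨ solve 3 (λ p i q → p :* i :* q := i :* (p :* q)) refl p (inv p p≢0) q ⟩
  inv p p≢0 * (p * q)   ≡⟨ cong (inv p p≢0 *_) pq≡0 ⟩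
  inv p p≢0 * 0ℚ        ≡⟨ *-zeroʳ (inv p p≢0) ⟩
  0ℚ                    ∎)

_≈[_]_ : Series → ℕ → Series → Set
a ≈[ n ] b = ∀ {m} → m < n → a m ≡ b m

_·_ : ℚ → Series → Series
(p · a) n = p * a n

*ₛ-cong[] : ∀ {n a a′ b b′} → a ≈[ n ] a′ → b ≈[ n ] b′ → a *ₛ b ≈[ n ] a′ *ₛ b′
*ₛ-cong[] p q {m} m<n = sum-cong-≗ {suc m} λ i → cong₂ _*_
  (p (ℕ.≤-trans (Fin.toℕ<n i) m<n))
  (q (ℕ.≤-<-trans (ℕ.m∸n≤m m (toℕ i)) m<n))

*ₛ-cong : ∀ {a a′ b b′} → a ≗ a′ → b ≗ b′ → a *ₛ b ≗ a′ *ₛ b′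
*ₛ-cong p q n = sum-cong-≗ {suc n} λ i → cong₂ _*_ (p (toℕ i)) (q (n ∸ toℕ i))

*ₛ-distribʳ-+ₛ : ∀ a b c → (a +ₛ b) *ₛ c ≗ a *ₛ c +ₛ b *ₛ c
*ₛ-distribʳ-+ₛ a b c zero =
  solve 3 (λ a b c → (a :+ b) :* c :+ con 0ℚ := a :* c :+ con 0ℚ :+ (b :* c :+ con 0ℚ))
    refl (a 0) (b 0) (c 0)
*ₛ-distribʳ-+ₛ a b c (suc n) = trans
  (cong ((a 0 + b 0) * c (suc n) +_) (*ₛ-distribʳ-+ₛ (tail a) (tail b) c n))
  (solve 5 (λ a b c x y → (a :+ b) :* c :+ (x :+ y) := a :* c :+ x :+ (b :* c :+ y))
    refl (a 0) (b 0) (c (suc n)) _ _)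

*ₛ-distribˡ-+ₛ : ∀ a b c → a *ₛ (b +ₛ c) ≗ a *ₛ b +ₛ a *ₛ c
*ₛ-distribˡ-+ₛ a b c zero =
  solve 3 (λ a b c → a :* (b :+ c) :+ con 0ℚ := a :* b :+ con 0ℚ :+ (a :* c :+ con 0ℚ))
    refl (a 0) (b 0) (c 0)
*ₛ-distribˡ-+ₛ a b c (suc n) = trans
  (cong (a 0 * (b (suc n) + c (suc n)) +_) (*ₛ-distribˡ-+ₛ (tail a) b c n))
  (solve 5 (λ a b c x y → a :* (b :+ c) :+ (x :+ y) := a :* b :+ x :+ (a :* c :+ y))
    refl (a 0) (b (suc n)) (c (suc n)) _ _)

·-*ₛ-assoc : ∀ p a b → (p · a) *ₛ b ≗ p · (a *ₛ b)
·-*ₛ-assoc p a b zero =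
  solve 3 (λ p a b → p :* a :* b :+ con 0ℚ := p :* (a :* b :+ con 0ℚ)) refl p (a 0) (b 0)
·-*ₛ-assoc p a b (suc n) = trans
  (cong (p * a 0 * b (suc n) +_) (·-*ₛ-assoc p (tail a) b n))
  (solve 4 (λ p a b x → p :* a :* b :+ p :* x := p :* (a :* b :+ x)) refl p (a 0) (b (suc n)) _)

*ₛ-·-comm : ∀ p a b → a *ₛ (p · b) ≗ p · (a *ₛ b)
*ₛ-·-comm p a b zero =
  solve 3 (λ p a b → a :* (p :* b) :+ con 0ℚ := p :* (a :* b :+ con 0ℚ)) refl p (a 0) (b 0)
*ₛ-·-comm p a b (suc n) = trans
  (cong (a 0 * (p * b (suc n)) +_) (*ₛ-·-comm p (tail a) b n))
  (solve 4 (λ p a b x → a :* (p :* b) :+ p :* x := p :* (a :* b :+ x)) refl p (a 0) (b (suc n)) _)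

*ₛ-assoc : ∀ a b c → (a *ₛ b) *ₛ c ≗ a *ₛ (b *ₛ c)
*ₛ-assoc a b c zero =
  solve 3 (λ a b c → (a :* b :+ con 0ℚ) :* c :+ con 0ℚ := a :* (b :* c :+ con 0ℚ) :+ con 0ℚ)
    refl (a 0) (b 0) (c 0)
*ₛ-assoc a b c (suc n) = begin
  h + ((a 0 · tail b +ₛ tail a *ₛ b) *ₛ c) n
    ≡⟨ cong (h +_) (*ₛ-distribʳ-+ₛ (a 0 · tail b) (tail a *ₛ b) c n) ⟩
  h + (((a 0 · tail b) *ₛ c) n + ((tail a *ₛ b) *ₛ c) n)
    ≡⟨ cong (h +_) (cong₂ _+_ (·-*ₛ-assoc (a 0) (tail b) c n) (*ₛ-assoc (tail a) b c n)) ⟩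
  h + (a 0 * (tail b *ₛ c) n + (tail a *ₛ (b *ₛ c)) n)
    ≡⟨ solve 5 (λ a b c x y → (a :* b :+ con 0ℚ) :* c :+ (a :* x :+ y) := a :* (b :* c :+ x) :+ y)
         refl (a 0) (b 0) (c (suc n)) ((tail b *ₛ c) n) _ ⟩
  (a *ₛ (b *ₛ c)) (suc n) ∎
  where h = (a *ₛ b) 0 * c (suc n)

sum-zero : ∀ {n} {f : Fin n → ℚ} → (∀ i → f i ≡ 0ℚ) → sum f ≡ 0ℚ
sum-zero {zero}  f≡0 = refl
sum-zero {suc n} f≡0 = cong₂ _+_ (f≡0 _) (sum-zero (λ i → f≡0 (Fin.suc i)))

0ₛ-*ₛ : ∀ a → 0ₛ *ₛ a ≗ 0ₛ
0ₛ-*ₛ a n = sum-zero {suc n} λ i → *-zeroˡ (a (n ∸ toℕ i))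

1ₛ-*ₛ : ∀ a → 1ₛ *ₛ a ≗ a
1ₛ-*ₛ a zero    = trans (+-identityʳ _) (*-identityˡ (a 0))
1ₛ-*ₛ a (suc n) = trans (cong₂ _+_ (*-identityˡ (a (suc n))) (0ₛ-*ₛ a n)) (+-identityʳ _)

*ₛ-prefix-0 : ∀ {n} a {b} → b ≈[ n ] 0ₛ → a *ₛ b ≈[ n ] 0ₛ
*ₛ-prefix-0 a b≈0 {m} m<n = trans (*ₛ-cong[] {a = a} (λ _ → refl) b≈0 m<n)
  (sum-zero {suc m} λ i → *-zeroʳ (a (toℕ i)))

*ₛ-lead : ∀ n a {b} → b ≈[ n ] 0ₛ → (a *ₛ b) n ≡ a 0 * b n
*ₛ-lead zero    a {b} b≈0 = +-identityʳ (a 0 * b 0)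
*ₛ-lead (suc n) a {b} b≈0 = trans
  (cong (a 0 * b (suc n) +_) (*ₛ-prefix-0 (tail a) b≈0 (ℕ.n<1+n n))) (+-identityʳ (a 0 * b (suc n)))

module _ (w : Series) (w₀≡0 : w 0 ≡ 0ℚ) where

  *ₛ-zero : ∀ b → (w *ₛ b) 0 ≡ 0ℚ
  *ₛ-zero b rewrite w₀≡0 = trans (+-identityʳ _) (*-zeroˡ (b 0))

  *ₛ-suc : ∀ b n → (w *ₛ b) (suc n) ≡ (tail w *ₛ b) n
  *ₛ-suc b n rewrite w₀≡0 = trans
    (cong (_+ (tail w *ₛ b) n) (*-zeroˡ (b (suc n)))) (+-identityˡ ((tail w *ₛ b) n))

  *ₛ-contract : ∀ {n a b} → a ≈[ n ] b → w *ₛ a ≈[ suc n ] w *ₛ b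
  *ₛ-contract {a = a} {b} a≈b {zero}  _         = trans (*ₛ-zero a) (sym (*ₛ-zero b))
  *ₛ-contract {a = a} {b} a≈b {suc m} (s≤s m<n) = begin
    (w *ₛ a) (suc m)  ≡⟨ *ₛ-suc a m ⟩
    (tail w *ₛ a) m   ≡⟨ *ₛ-cong[] {a = tail w} (λ _ → refl) a≈b m<n ⟩
    (tail w *ₛ b) m   ≡⟨ *ₛ-suc b m ⟨
    (w *ₛ b) (suc m)  ∎

  ^ₛ-prefix-0 : ∀ k → w ^ₛ k ≈[ k ] 0ₛ
  ^ₛ-prefix-0 (suc k) {zero}  _         = *ₛ-zero (w ^ₛ k)
  ^ₛ-prefix-0 (suc k) {suc m} (s≤s m<k) =
    trans (*ₛ-suc (w ^ₛ k) m) (*ₛ-prefix-0 (tail w) (^ₛ-prefix-0 k) m<k)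

  ^ₛ-diagonal : w 1 ≢ 0ℚ → ∀ k → (w ^ₛ k) k ≢ 0ℚ
  ^ₛ-diagonal w₁≢0 zero    = 1≢0
  ^ₛ-diagonal w₁≢0 (suc k) = subst (_≢ 0ℚ)
    (sym (trans (*ₛ-suc (w ^ₛ k) k) (*ₛ-lead k (tail w) (^ₛ-prefix-0 k))))
    (*-≢0 w₁≢0 (^ₛ-diagonal w₁≢0 k))

∘ₛ-congˡ : ∀ {a a′} w → a ≗ a′ → a ∘ₛ w ≗ a′ ∘ₛ w
∘ₛ-congˡ w p n = sum-cong-≗ {suc n} λ k → cong (_* (w ^ₛ toℕ k) n) (p (toℕ k))

^ₛ-cong : ∀ {w w′} → w ≗ w′ → ∀ k → w ^ₛ k ≗ w′ ^ₛ k
^ₛ-cong p zero    = λ _ → refl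
^ₛ-cong p (suc k) = *ₛ-cong p (^ₛ-cong p k)

∘ₛ-congʳ : ∀ a {w w′} → w ≗ w′ → a ∘ₛ w ≗ a ∘ₛ w′
∘ₛ-congʳ a p n = sum-cong-≗ {suc n} λ k → cong (a (toℕ k) *_) (^ₛ-cong p (toℕ k) n)

∘ₛ-+ₛ : ∀ a b w → (a +ₛ b) ∘ₛ w ≗ a ∘ₛ w +ₛ b ∘ₛ w
∘ₛ-+ₛ a b w n = trans
  (sum-cong-≗ {suc n} λ k → *-distribʳ-+ ((w ^ₛ toℕ k) n) (a (toℕ k)) (b (toℕ k)))
  (∑-distrib-+ {suc n} (λ k → a (toℕ k) * (w ^ₛ toℕ k) n) (λ k → b (toℕ k) * (w ^ₛ toℕ k) n))

∘ₛ-· : ∀ p a w → (p · a) ∘ₛ w ≗ p · (a ∘ₛ w)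
∘ₛ-· p a w n = trans
  (sum-cong-≗ {suc n} λ k → *-assoc p (a (toℕ k)) ((w ^ₛ toℕ k) n))
  (sym (*-distribˡ-sum {suc n} p (λ k → a (toℕ k) * (w ^ₛ toℕ k) n)))

∘ₛ-head : ∀ a w → (a ∘ₛ w) 0 ≡ a 0
∘ₛ-head a w = trans (+-identityʳ _) (*-identityʳ (a 0))

sum-extend : ∀ {m n} (f : ℕ → ℚ) → m ≤ n → (∀ {k} → m < k → f k ≡ 0ℚ) →
             ∑[ k ≤ m ] f (toℕ k) ≡ ∑[ k ≤ n ] f (toℕ k)
sum-extend {n = n} f z≤n f≡0 =
  cong (f 0 +_) (sym (sum-zero {n} λ i → f≡0 (s≤s z≤n)))
sum-extend f (s≤s m≤n) f≡0 =
  cong (f 0 +_) (sum-extend (λ k → f (suc k)) m≤n (λ m<k → f≡0 (s≤s m<k)))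

*ₛ-∑ : ∀ {N} u (f : Fin N → Series) →
       u *ₛ (λ m → ∑[ k < N ] f k m) ≗ (λ n → ∑[ k < N ] (u *ₛ f k) n)
*ₛ-∑ u f n = trans
  (sum-cong-≗ {suc n} λ i → *-distribˡ-sum (u (toℕ i)) (λ k → f k (n ∸ toℕ i)))
  (∑-comm {suc n} λ i k → u (toℕ i) * f k (n ∸ toℕ i))

module _ (w : Series) (w₀≡0 : w 0 ≡ 0ℚ) where

  ∘ₛ-horner : ∀ a → a ∘ₛ w ≗ a 0 · 1ₛ +ₛ w *ₛ (tail a ∘ₛ w)
  ∘ₛ-horner a zero = cong (a 0 * 1ℚ +_) (sym (*ₛ-zero w w₀≡0 (tail a ∘ₛ w)))
  ∘ₛ-horner a (suc n) = cong (a 0 * 0ℚ +_) (begin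
    ∑[ k ≤ n ] (c k * (w *ₛ w ^ₛ toℕ k) (suc n))
      ≡⟨ sum-cong-≗ {suc n} (λ k → cong (c k *_) (*ₛ-suc w w₀≡0 (w ^ₛ toℕ k) n)) ⟩
    ∑[ k ≤ n ] (c k * (tail w *ₛ w ^ₛ toℕ k) n)
      ≡⟨ sum-cong-≗ {suc n} (λ k → *ₛ-·-comm (c k) (tail w) (w ^ₛ toℕ k) n) ⟨
    ∑[ k ≤ n ] (tail w *ₛ (c k · w ^ₛ toℕ k)) n
      ≡⟨ *ₛ-∑ {suc n} (tail w) (λ k → c k · w ^ₛ toℕ k) n ⟨
    (tail w *ₛ (λ m → ∑[ k ≤ n ] (c k * (w ^ₛ toℕ k) m))) n
      ≡⟨ *ₛ-cong[] {a = tail w} (λ _ → refl) truncate (ℕ.n<1+n n) ⟨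
    (tail w *ₛ (tail a ∘ₛ w)) n
      ≡⟨ *ₛ-suc w w₀≡0 (tail a ∘ₛ w) n ⟨
    (w *ₛ (tail a ∘ₛ w)) (suc n) ∎)
    where
    c : Fin (suc n) → ℚ
    c k = tail a (toℕ k)
    truncate : tail a ∘ₛ w ≈[ suc n ] (λ m → ∑[ k ≤ n ] (c k * (w ^ₛ toℕ k) m))
    truncate {m} (s≤s m≤n) = sum-extend (λ k → tail a k * (w ^ₛ k) m) m≤n λ {k} m<k →
      trans (cong (tail a k *_) (^ₛ-prefix-0 w w₀≡0 k m<k)) (*-zeroʳ (tail a k))

  ∘ₛ-*ₛ[] : ∀ n a b → (a *ₛ b) ∘ₛ w ≈[ n ] (a ∘ₛ w) *ₛ (b ∘ₛ w)
  ∘ₛ-*ₛ[] (suc n) a b {m} m<1+n = begin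
    ((a *ₛ b) ∘ₛ w) m
      ≡⟨ ∘ₛ-horner (a *ₛ b) m ⟩
    (a 0 * b 0 + 0ℚ) * e + (w *ₛ (tail (a *ₛ b) ∘ₛ w)) m
      ≡⟨ cong (h +_) (*ₛ-contract w w₀≡0 {a = tail (a *ₛ b) ∘ₛ w} {b = a 0 · B′ +ₛ A′ *ₛ B} tail-∘ m<1+n) ⟩
    (a 0 * b 0 + 0ℚ) * e + (w *ₛ (a 0 · B′ +ₛ A′ *ₛ B)) m
      ≡⟨ cong (h +_) (*ₛ-distribˡ-+ₛ w (a 0 · B′) (A′ *ₛ B) m) ⟩
    (a 0 * b 0 + 0ℚ) * e + ((w *ₛ (a 0 · B′)) m + (w *ₛ (A′ *ₛ B)) m)
      ≡⟨ cong (h +_) (cong₂ _+_ (*ₛ-·-comm (a 0) w B′ m) (sym (*ₛ-assoc w A′ B m))) ⟩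
    (a 0 * b 0 + 0ℚ) * e + (a 0 * (w *ₛ B′) m + ((w *ₛ A′) *ₛ B) m)
      ≡⟨ solve 5 (λ a b e x y → (a :* b :+ con 0ℚ) :* e :+ (a :* x :+ y) := a :* (b :* e :+ x) :+ y)
           refl (a 0) (b 0) e ((w *ₛ B′) m) _ ⟩
    a 0 * (b 0 * e + (w *ₛ B′) m) + ((w *ₛ A′) *ₛ B) m
      ≡⟨ cong (λ z → a 0 * z + ((w *ₛ A′) *ₛ B) m) (∘ₛ-horner b m) ⟨
    a 0 * B m + ((w *ₛ A′) *ₛ B) m
      ≡⟨ cong (λ z → a 0 * z + ((w *ₛ A′) *ₛ B) m) (1ₛ-*ₛ B m) ⟨
    a 0 * (1ₛ *ₛ B) m + ((w *ₛ A′) *ₛ B) m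
      ≡⟨ cong (_+ ((w *ₛ A′) *ₛ B) m) (·-*ₛ-assoc (a 0) 1ₛ B m) ⟨
    ((a 0 · 1ₛ) *ₛ B) m + ((w *ₛ A′) *ₛ B) m
      ≡⟨ *ₛ-distribʳ-+ₛ (a 0 · 1ₛ) (w *ₛ A′) B m ⟨
    ((a 0 · 1ₛ +ₛ w *ₛ A′) *ₛ B) m
      ≡⟨ *ₛ-cong {b = B} (∘ₛ-horner a) (λ _ → refl) m ⟨
    ((a ∘ₛ w) *ₛ B) m ∎
    where
    e = 1ₛ m
    h = (a 0 * b 0 + 0ℚ) * e
    A′ = tail a ∘ₛ w
    B  = b ∘ₛ w
    B′ = tail b ∘ₛ w
    tail-∘ : tail (a *ₛ b) ∘ₛ w ≈[ n ] a 0 · B′ +ₛ A′ *ₛ B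
    tail-∘ {i} i<n = trans (∘ₛ-+ₛ (a 0 · tail b) (tail a *ₛ b) w i)
      (cong₂ _+_ (∘ₛ-· (a 0) (tail b) w i) (∘ₛ-*ₛ[] n (tail a) b i<n))

  ∘ₛ-*ₛ : ∀ a b → (a *ₛ b) ∘ₛ w ≗ (a ∘ₛ w) *ₛ (b ∘ₛ w)
  ∘ₛ-*ₛ a b n = ∘ₛ-*ₛ[] (suc n) a b (ℕ.n<1+n n)

1ₛ-∘ₛ : ∀ w → 1ₛ ∘ₛ w ≗ 1ₛ
1ₛ-∘ₛ w n = trans
  (cong₂ _+_ (*-identityˡ (1ₛ n)) (sum-zero {n} λ k → *-zeroˡ ((w ^ₛ suc (toℕ k)) n))) (+-identityʳ (1ₛ n))

*ₛ-1ₛ : ∀ a → a *ₛ 1ₛ ≗ a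
*ₛ-1ₛ a zero    = trans (+-identityʳ _) (*-identityʳ (a 0))
*ₛ-1ₛ a (suc n) = trans (cong₂ _+_ (*-zeroʳ (a 0)) (*ₛ-1ₛ (tail a) n)) (+-identityˡ _)

module _ (w : Series) (w₀≡0 : w 0 ≡ 0ℚ) where

  X-∘ₛ : X ∘ₛ w ≗ w
  X-∘ₛ n = begin
    (X ∘ₛ w) n                          ≡⟨ ∘ₛ-horner w w₀≡0 X n ⟩
    0ℚ * 1ₛ n + (w *ₛ (1ₛ ∘ₛ w)) n      ≡⟨ cong₂ _+_ (*-zeroˡ (1ₛ n)) (*ₛ-cong {w} (λ _ → refl) (1ₛ-∘ₛ w) n) ⟩
    0ℚ + (w *ₛ 1ₛ) n                    ≡⟨ +-identityˡ _ ⟩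
    (w *ₛ 1ₛ) n                         ≡⟨ *ₛ-1ₛ w n ⟩
    w n                                 ∎

∘ₛ-X : ∀ a → a ∘ₛ X ≗ a
∘ₛ-X a zero    = ∘ₛ-head a X
∘ₛ-X a (suc n) = begin
  (a ∘ₛ X) (suc n)                            ≡⟨ ∘ₛ-horner X refl a (suc n) ⟩
  a 0 * 0ℚ + (X *ₛ (tail a ∘ₛ X)) (suc n)     ≡⟨ cong₂ _+_ (*-zeroʳ (a 0)) (*ₛ-suc X refl (tail a ∘ₛ X) n) ⟩
  0ℚ + (1ₛ *ₛ (tail a ∘ₛ X)) n                ≡⟨ +-identityˡ _ ⟩
  (1ₛ *ₛ (tail a ∘ₛ X)) n                     ≡⟨ 1ₛ-*ₛ (tail a ∘ₛ X) n ⟩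
  (tail a ∘ₛ X) n                             ≡⟨ ∘ₛ-X (tail a) n ⟩
  a (suc n)                                   ∎

module _ (w v : Series) (w₀≡0 : w 0 ≡ 0ℚ) (v₀≡0 : v 0 ≡ 0ℚ) where

  ∘ₛ-assoc[] : ∀ n a → (a ∘ₛ w) ∘ₛ v ≈[ n ] a ∘ₛ (w ∘ₛ v)
  ∘ₛ-assoc[] (suc n) a {m} m<1+n = begin
    ((a ∘ₛ w) ∘ₛ v) m
      ≡⟨ ∘ₛ-congˡ v (∘ₛ-horner w w₀≡0 a) m ⟩
    ((a 0 · 1ₛ +ₛ w *ₛ (tail a ∘ₛ w)) ∘ₛ v) m
      ≡⟨ ∘ₛ-+ₛ (a 0 · 1ₛ) (w *ₛ (tail a ∘ₛ w)) v m ⟩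
    ((a 0 · 1ₛ) ∘ₛ v) m + ((w *ₛ (tail a ∘ₛ w)) ∘ₛ v) m
      ≡⟨ cong₂ _+_ (trans (∘ₛ-· (a 0) 1ₛ v m) (cong (a 0 *_) (1ₛ-∘ₛ v m)))
                   (∘ₛ-*ₛ v v₀≡0 w (tail a ∘ₛ w) m) ⟩
    a 0 * 1ₛ m + ((w ∘ₛ v) *ₛ ((tail a ∘ₛ w) ∘ₛ v)) m
      ≡⟨ cong (a 0 * 1ₛ m +_) (*ₛ-contract (w ∘ₛ v) wv₀≡0 {a = (tail a ∘ₛ w) ∘ₛ v} {b = tail a ∘ₛ (w ∘ₛ v)} (∘ₛ-assoc[] n (tail a)) m<1+n) ⟩
    a 0 * 1ₛ m + ((w ∘ₛ v) *ₛ (tail a ∘ₛ (w ∘ₛ v))) m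
      ≡⟨ ∘ₛ-horner (w ∘ₛ v) wv₀≡0 a m ⟨
    (a ∘ₛ (w ∘ₛ v)) m ∎
    where
    wv₀≡0 : (w ∘ₛ v) 0 ≡ 0ℚ
    wv₀≡0 = trans (∘ₛ-head w v) w₀≡0

  ∘ₛ-assoc : ∀ a → (a ∘ₛ w) ∘ₛ v ≗ a ∘ₛ (w ∘ₛ v)
  ∘ₛ-assoc a n = ∘ₛ-assoc[] (suc n) a (ℕ.n<1+n n)

open 𝓕₀ using () renaming (series to ⌊_⌋₀)
open 𝓕₁ using () renaming (series to ⌊_⌋₁)

diagonal : ∀ {a : Series} → a 0 ≢ 0ℚ → ∀ n → a (n ∸ n) ≢ 0ℚ
diagonal {a} a₀≢0 n = subst (λ i → a i ≢ 0ℚ) (sym (ℕ.n∸n≡0 n)) a₀≢0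

-- The coefficients r of 1/a solve  ∑_{k ≤ n} aₙ₋ₖ rₖ = [xⁿ] 1.
recipₛ : (a : Series) → a 0 ≢ 0ℚ → Series
recipₛ a a₀≢0 = solveLT (λ n k → a (n ∸ k)) (diagonal {a} a₀≢0) 1ₛ

recipₛ-inverseˡ : ∀ a a₀≢0 → recipₛ a a₀≢0 *ₛ a ≗ 1ₛ
recipₛ-inverseˡ a a₀≢0 n = trans
  (sum-cong-≗ {suc n} λ k → *-comm (recipₛ a a₀≢0 (toℕ k)) (a (n ∸ toℕ k)))
  (solveLT-correct (λ n k → a (n ∸ k)) (diagonal {a} a₀≢0) 1ₛ n)

1/₀_ : 𝓕₀ → 𝓕₀
1/₀ (mk𝓕₀ a a₀≢0) = mk𝓕₀ (recipₛ a a₀≢0) λ r₀≡0 → 1≢0 (begin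
  1ℚ                             ≡⟨ recipₛ-inverseˡ a a₀≢0 0 ⟨
  recipₛ a a₀≢0 0 * a 0 + 0ℚ     ≡⟨ +-identityʳ _ ⟩
  recipₛ a a₀≢0 0 * a 0          ≡⟨ cong (_* a 0) r₀≡0 ⟩
  0ℚ * a 0                       ≡⟨ *-zeroˡ (a 0) ⟩
  0ℚ                             ∎)

_⟨_⟩ : 𝓕₀ → 𝓕₁ → 𝓕₀
mk𝓕₀ a a₀≢0 ⟨ w ⟩ = mk𝓕₀ (a ∘ₛ ⌊ w ⌋₁) (subst (_≢ 0ℚ) (sym (∘ₛ-head a ⌊ w ⌋₁)) a₀≢0)

X/₀_ : 𝓕₀ → 𝓕₁
X/₀ f = mk𝓕₁ (X *ₛ r) (*ₛ-zero X refl r)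
  (subst (_≢ 0ℚ) (sym (trans (*ₛ-suc X refl r 0) (1ₛ-*ₛ r 0))) (𝓕₀.c₀≢0 (1/₀ f)))
  where r = ⌊ 1/₀ f ⌋₀

-- Cancelling the factor x,  x / w = 1 / (w / x).
X/₁_ : 𝓕₁ → 𝓕₀
X/₁ (mk𝓕₁ w _ w₁≢0) = 1/₀ (mk𝓕₀ (tail w) w₁≢0)

-- The coefficients r of Rev(v) solve  ∑_{k ≤ n} [xⁿ] vᵏ · rₖ = [xⁿ] x,  i.e.
-- Rev(v) ∘ v = x.  That also v ∘ Rev(v) = x is Rev-inverseʳ.
Revₛ : (v : Series) → v 0 ≡ 0ℚ → v 1 ≢ 0ℚ → Series
Revₛ v v₀≡0 v₁≢0 = solveLT (λ n k → (v ^ₛ k) n) (^ₛ-diagonal v v₀≡0 v₁≢0) X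

Revₛ-inverseˡ : ∀ v v₀≡0 v₁≢0 → Revₛ v v₀≡0 v₁≢0 ∘ₛ v ≗ X
Revₛ-inverseˡ v v₀≡0 v₁≢0 n = trans
  (sum-cong-≗ {suc n} λ k → *-comm (Revₛ v v₀≡0 v₁≢0 (toℕ k)) ((v ^ₛ toℕ k) n))
  (solveLT-correct (λ n k → (v ^ₛ k) n) (^ₛ-diagonal v v₀≡0 v₁≢0) X n)

Rev : 𝓕₁ → 𝓕₁
Rev (mk𝓕₁ v v₀≡0 v₁≢0) = mk𝓕₁ w (*-zeroʳ (inv 1ℚ 1≢0)) λ w₁≡0 → 1≢0 (begin
  1ℚ                                        ≡⟨ Revₛ-inverseˡ v v₀≡0 v₁≢0 1 ⟨
  w 0 * 0ℚ + (w 1 * (v ^ₛ 1) 1 + 0ℚ)        ≡⟨ cong₂ (λ p q → p + (q * (v ^ₛ 1) 1 + 0ℚ)) (*-zeroʳ (w 0)) w₁≡0 ⟩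
  0ℚ + (0ℚ * (v ^ₛ 1) 1 + 0ℚ)               ≡⟨ solve 1 (λ z → con 0ℚ :+ (con 0ℚ :* z :+ con 0ℚ) := con 0ℚ) refl ((v ^ₛ 1) 1) ⟩
  0ℚ                                        ∎)
  where
  w : Series
  w = Revₛ v v₀≡0 v₁≢0

Rev-inverseˡ : ∀ v → ⌊ Rev v ⌋₁ ∘ₛ ⌊ v ⌋₁ ≗ X
Rev-inverseˡ (mk𝓕₁ v v₀≡0 v₁≢0) = Revₛ-inverseˡ v v₀≡0 v₁≢0

Rev-inverseʳ : ∀ v → ⌊ v ⌋₁ ∘ₛ ⌊ Rev v ⌋₁ ≗ X
Rev-inverseʳ v n = trans (∘ₛ-congˡ w v≗u n) (Rev-inverseˡ (Rev v) n)
  where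
  w = ⌊ Rev v ⌋₁
  u = ⌊ Rev (Rev v) ⌋₁
  v≗u : ⌊ v ⌋₁ ≗ u
  v≗u i = begin
    ⌊ v ⌋₁ i                  ≡⟨ X-∘ₛ ⌊ v ⌋₁ (𝓕₁.c₀≡0 v) i ⟨
    (X ∘ₛ ⌊ v ⌋₁) i           ≡⟨ ∘ₛ-congˡ ⌊ v ⌋₁ (Rev-inverseˡ (Rev v)) i ⟨
    ((u ∘ₛ w) ∘ₛ ⌊ v ⌋₁) i    ≡⟨ ∘ₛ-assoc w ⌊ v ⌋₁ (𝓕₁.c₀≡0 (Rev v)) (𝓕₁.c₀≡0 v) u i ⟩
    (u ∘ₛ (w ∘ₛ ⌊ v ⌋₁)) i    ≡⟨ ∘ₛ-congʳ u (Rev-inverseˡ v) i ⟩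
    (u ∘ₛ X) i                ≡⟨ ∘ₛ-X u i ⟩
    u i                       ∎

record LowerTriangular : Set where
  field
    entry : ℕ → ℕ → ℚ
    upper : ∀ {n k} → n < k → entry n k ≡ 0ℚ

open LowerTriangular

-- ∑_{j ≥ 0} A n j · B j k, whose terms with j > n vanish.
mulEntry : LowerTriangular → LowerTriangular → ℕ → ℕ → ℚ
mulEntry A B n k = ∑[ j ≤ n ] (entry A n (toℕ j) * entry B (toℕ j) k)

identityEntry : ℕ → ℕ → ℚ
identityEntry zero    zero    = 1ℚ
identityEntry zero    (suc _) = 0ℚ
identityEntry (suc _) zero    = 0ℚ
identityEntry (suc n) (suc k) = identityEntry n k

IsInverse : LowerTriangular → LowerTriangular → Set
IsInverse A B =
  (∀ n k → mulEntry A B n k ≡ identityEntry n k) ×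
  (∀ n k → mulEntry B A n k ≡ identityEntry n k)

coeff-neg : ∀ a {n k} → n < k → [x^ n ⊖ k ] a ≡ 0ℚ
coeff-neg a {n} {k} n<k rewrite ℤ.⊖-< n<k with k ∸ n in eq
... | zero  = contradiction (ℕ.m∸n≡0⇒m≤n eq) (ℕ.<⇒≱ n<k)
... | suc _ = refl

⟪_,_⟫ : 𝓕₀ → 𝓕₀ → LowerTriangular
entry ⟪ g , f ⟫ n k = [x^ n ⊖ k ] (⌊ g ⌋₀ *ₛ ⌊ f ⌋₀ ^ₛ n)
upper ⟪ g , f ⟫     = coeff-neg _

{-# OPTIONS --safe #-}

-- Put w = Rev(x/f), γ = 1/(g ∘ w) and φ = x/w, so that φ = 1/(f ∘ w) because
-- x = (x/f) ∘ w = w/(f ∘ w).  Since w φ = x, the entry [x^{j-k}] γ φʲ of the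
-- second matrix equals [x^{n-k}] γ φⁿ wⁿ⁻ʲ for every n ≥ j.  Summing it against
-- [x^{n-j}] g fⁿ therefore composes g fⁿ with w:  the (n,k) entry of the
-- product is  [x^{n-k}] γ φⁿ (g ∘ w) (f ∘ w)ⁿ = [x^{n-k}] 1.  The data of the
-- two matrices are related symmetrically, so the product in the other order is
-- the same computation.
module Submission where

open import Algebra.Bundles using (CommutativeMonoid; CommutativeRing)
import Algebra.Properties.CommutativeSemigroup as CommutativeSemigroupProperties
open import Data.Rational.Properties using (+-*-commutativeRing; *-comm; *-zeroʳ)
open import Algebra.Properties.Semiring.Sum
  (CommutativeRing.semiring +-*-commutativeRing)
  using (sum⁺-syntax; sum-cong-≗; sum-permute)
open import Data.Fin.Base using (toℕ)
open import Data.Fin.Permutation using (reverse)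
import Data.Fin.Properties as Fin
open import Data.Integer.Base as ℤ using (-[1+_]; _⊖_) renaming (+_ to pos)
import Data.Integer.Properties as ℤ
open import Data.Nat.Base as ℕ using (ℕ; zero; suc; _∸_; _≤_; s≤s)
import Data.Nat.Properties as ℕ
open import Data.Product.Base using (_,_)
open import Data.Rational.Base using (ℚ; 0ℚ; _*_)
open import Level using (0ℓ)
open import Relation.Binary.Bundles using (Setoid)
open import Relation.Binary.PropositionalEquality
import Relation.Binary.Reasoning.Setoid as SetoidReasoning
open import Relation.Nullary.Decidable.Core using (yes; no)

open import Defs

open 𝓕₀ using () renaming (series to ⌊_⌋₀)
open 𝓕₁ using () renaming (series to ⌊_⌋₁)
open LowerTriangular

-- Commutativity and powers of the series product, integer-indexed coefficients.

sum-reverse : ∀ n (t : ℕ → ℚ) → ∑[ i ≤ n ] t (toℕ i) ≡ ∑[ i ≤ n ] t (n ∸ toℕ i)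
sum-reverse n t = trans (sum-permute (λ i → t (toℕ i)) reverse)
  (sum-cong-≗ {suc n} λ i → cong t (Fin.opposite-prop i))

*ₛ-comm : ∀ a b → a *ₛ b ≗ b *ₛ a
*ₛ-comm a b n = trans (sum-reverse n λ i → a i * b (n ∸ i)) (sum-cong-≗ {suc n} λ i → trans
  (cong (λ j → a (n ∸ toℕ i) * b j) (ℕ.m∸[m∸n]≡n (Fin.toℕ≤pred[n] i)))
  (*-comm (a (n ∸ toℕ i)) (b (toℕ i))))

*ₛ-commutativeMonoid : CommutativeMonoid 0ℓ 0ℓ
*ₛ-commutativeMonoid = record
  { Carrier = Series
  ; _≈_     = _≗_
  ; _∙_     = _*ₛ_
  ; ε       = 1ₛ
  ; isCommutativeMonoid = record
    { isMonoid = record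
      { isSemigroup = record
        { isMagma = record
          { isEquivalence = Setoid.isEquivalence (ℕ →-setoid ℚ)
          ; ∙-cong        = *ₛ-cong
          }
        ; assoc = *ₛ-assoc
        }
      ; identity = 1ₛ-*ₛ , *ₛ-1ₛ
      }
    ; comm = *ₛ-comm
    }
  }

open CommutativeMonoid *ₛ-commutativeMonoid
  using (commutativeSemigroup)
  renaming (sym to ≗-sym; trans to ≗-trans)
open CommutativeSemigroupProperties commutativeSemigroup
  using (interchange; x∙yz≈y∙xz)
module ≗-Reasoning = SetoidReasoning (ℕ →-setoid ℚ)

*ₛ-congˡ : ∀ a {b b′} → b ≗ b′ → a *ₛ b ≗ a *ₛ b′
*ₛ-congˡ a = *ₛ-cong {a} (λ _ → refl)

*ₛ-congʳ : ∀ b {a a′} → a ≗ a′ → a *ₛ b ≗ a′ *ₛ b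
*ₛ-congʳ b a≗a′ = *ₛ-cong {b = b} a≗a′ (λ _ → refl)

1ₛ-^ₛ : ∀ n → 1ₛ ^ₛ n ≗ 1ₛ
1ₛ-^ₛ zero    _ = refl
1ₛ-^ₛ (suc n) = ≗-trans (1ₛ-*ₛ (1ₛ ^ₛ n)) (1ₛ-^ₛ n)

^ₛ-distrib-*ₛ : ∀ a b n → (a *ₛ b) ^ₛ n ≗ a ^ₛ n *ₛ b ^ₛ n
^ₛ-distrib-*ₛ a b zero    = ≗-sym (1ₛ-*ₛ 1ₛ)
^ₛ-distrib-*ₛ a b (suc n) = ≗-trans (*ₛ-congˡ (a *ₛ b) (^ₛ-distrib-*ₛ a b n))
  (interchange a b (a ^ₛ n) (b ^ₛ n))

[x^_]-cong : ∀ z {a b} → a ≗ b → [x^ z ] a ≡ [x^ z ] b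
[x^ pos m    ]-cong a≗b = a≗b m
[x^ -[1+ _ ] ]-cong _   = refl

[x^n⊖k]1ₛ : ∀ n k → [x^ n ⊖ k ] 1ₛ ≡ identityEntry n k
[x^n⊖k]1ₛ zero    zero    = refl
[x^n⊖k]1ₛ zero    (suc k) = refl
[x^n⊖k]1ₛ (suc n) zero    = refl
[x^n⊖k]1ₛ (suc n) (suc k) =
  trans (cong ([x^_] 1ₛ) (ℤ.[1+m]⊖[1+n]≡m⊖n n k)) ([x^n⊖k]1ₛ n k)

tail-X*ₛ : ∀ a → tail (X *ₛ a) ≗ a
tail-X*ₛ a n = trans (*ₛ-suc X refl a n) (1ₛ-*ₛ a n)

-- Series w with zero constant term: composition, degree shifts, the matrix product.

module _ (w : Series) (w₀≡0 : w 0 ≡ 0ℚ) where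

  X*ₛtail : w ≗ X *ₛ tail w
  X*ₛtail zero    = trans w₀≡0 (sym (*ₛ-zero X refl (tail w)))
  X*ₛtail (suc n) = sym (tail-X*ₛ (tail w) n)

  ∘ₛ-^ₛ : ∀ a n → (a ^ₛ n) ∘ₛ w ≗ (a ∘ₛ w) ^ₛ n
  ∘ₛ-^ₛ a zero    = 1ₛ-∘ₛ w
  ∘ₛ-^ₛ a (suc n) = ≗-trans (∘ₛ-*ₛ w w₀≡0 a (a ^ₛ n)) (*ₛ-congˡ (a ∘ₛ w) (∘ₛ-^ₛ a n))

  ∘ₛ-inverse : ∀ a b → a *ₛ b ≗ 1ₛ → (a ∘ₛ w) *ₛ (b ∘ₛ w) ≗ 1ₛ
  ∘ₛ-inverse a b ab≗1 = begin
    (a ∘ₛ w) *ₛ (b ∘ₛ w)  ≈⟨ ∘ₛ-*ₛ w w₀≡0 a b ⟨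
    (a *ₛ b) ∘ₛ w         ≈⟨ ∘ₛ-congˡ w ab≗1 ⟩
    1ₛ ∘ₛ w               ≈⟨ 1ₛ-∘ₛ w ⟩
    1ₛ                    ∎
    where open ≗-Reasoning

  -- Here w = x · `tail w`. The exponent is an integer so that entries above the diagonal need no
  -- separate treatment; at z = -1 the left side is the constant term of w a, which vanishes by
  -- `w₀≡0`.
  [x^suc]-*ₛ : ∀ a z → [x^ ℤ.suc z ] (w *ₛ a) ≡ [x^ z ] (tail w *ₛ a)
  [x^suc]-*ₛ a (pos m)      = *ₛ-suc w w₀≡0 a m
  [x^suc]-*ₛ a -[1+ zero  ] = *ₛ-zero w w₀≡0 a
  [x^suc]-*ₛ a -[1+ suc _ ] = refl

  -- Since wⁱ has no terms of degree below i, cutting the composition off at any n ≥ m leaves the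
  -- coefficient of xᵐ unchanged. The slack is needed because row n is summed up to n while the
  -- coefficient taken is that of xⁿ⁻ᵏ.
  *ₛ-∘ₛ : ∀ {m n} → m ≤ n → ∀ p a →
          ∑[ i ≤ n ] (a (toℕ i) * (p *ₛ w ^ₛ toℕ i) m) ≡ (p *ₛ (a ∘ₛ w)) m
  *ₛ-∘ₛ {m} {n} m≤n p a = begin
    ∑[ i ≤ n ] (a (toℕ i) * (p *ₛ w ^ₛ toℕ i) m)
      ≡⟨ sum-cong-≗ {suc n} (λ i → *ₛ-·-comm (a (toℕ i)) p (w ^ₛ toℕ i) m) ⟨
    ∑[ i ≤ n ] (p *ₛ (a (toℕ i) · w ^ₛ toℕ i)) m
      ≡⟨ *ₛ-∑ {suc n} p (λ i → a (toℕ i) · w ^ₛ toℕ i) m ⟨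
    (p *ₛ (λ l → ∑[ i ≤ n ] (a (toℕ i) * (w ^ₛ toℕ i) l))) m
      ≡⟨ *ₛ-cong[] {a = p} (λ _ → refl) truncate (s≤s m≤n) ⟨
    (p *ₛ (a ∘ₛ w)) m ∎
    where
    open ≡-Reasoning
    truncate : a ∘ₛ w ≈[ suc n ] (λ l → ∑[ i ≤ n ] (a (toℕ i) * (w ^ₛ toℕ i) l))
    truncate {l} (s≤s l≤n) = sum-extend (λ i → a i * (w ^ₛ i) l) l≤n λ {i} l<i →
      trans (cong (a i *_) (^ₛ-prefix-0 w w₀≡0 i l<i)) (*-zeroʳ (a i))

  [x^]-*ₛ-∘ₛ : ∀ n k p a →
               ∑[ i ≤ n ] (a (toℕ i) * [x^ n ⊖ k ] (p *ₛ w ^ₛ toℕ i)) ≡ [x^ n ⊖ k ] (p *ₛ (a ∘ₛ w))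
  [x^]-*ₛ-∘ₛ n k p a with k ℕ.≤? n
  ... | yes k≤n rewrite ℤ.⊖-≥ k≤n = *ₛ-∘ₛ (ℕ.m∸n≤m n k) p a
  ... | no  k≰n = trans
    (sum-zero {suc n} λ i → trans
      (cong (a (toℕ i) *_) (coeff-neg (p *ₛ w ^ₛ toℕ i) (ℕ.≰⇒> k≰n))) (*-zeroʳ (a (toℕ i))))
    (sym (coeff-neg (p *ₛ (a ∘ₛ w)) (ℕ.≰⇒> k≰n)))

  -- Induction on i, each step multiplying by w φ = x. With i + j = n, entries from different rows j
  -- acquire the common factor γ φⁿ.
  [x^]-shift : ∀ γ φ → φ *ₛ tail w ≗ 1ₛ → ∀ i j k →
               [x^ j ⊖ k ] (γ *ₛ φ ^ₛ j) ≡
               [x^ (i ℕ.+ j) ⊖ k ] ((γ *ₛ φ ^ₛ (i ℕ.+ j)) *ₛ w ^ₛ i)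
  [x^]-shift γ φ φu≗1 zero    j k = [x^ j ⊖ k ]-cong (≗-sym (*ₛ-1ₛ (γ *ₛ φ ^ₛ j)))
  [x^]-shift γ φ φu≗1 (suc i) j k = begin
    [x^ j ⊖ k ] (γ *ₛ φ ^ₛ j)
      ≡⟨ [x^]-shift γ φ φu≗1 i j k ⟩
    [x^ m ⊖ k ] ((γ *ₛ φ ^ₛ m) *ₛ w ^ₛ i)
      -- Used right to left, `absorb` inserts φ · `tail w` = 1; raising the exponent by one then
      -- turns `tail w` into w.
      ≡⟨ [x^ m ⊖ k ]-cong absorb ⟨
    [x^ m ⊖ k ] (tail w *ₛ ((γ *ₛ φ ^ₛ suc m) *ₛ w ^ₛ i))
      ≡⟨ [x^suc]-*ₛ ((γ *ₛ φ ^ₛ suc m) *ₛ w ^ₛ i) (m ⊖ k) ⟨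
    [x^ ℤ.suc (m ⊖ k) ] (w *ₛ ((γ *ₛ φ ^ₛ suc m) *ₛ w ^ₛ i))
      ≡⟨ cong ([x^_] (w *ₛ ((γ *ₛ φ ^ₛ suc m) *ₛ w ^ₛ i))) (ℤ.distribʳ-⊖-+-pos 1 m k) ⟩
    [x^ suc m ⊖ k ] (w *ₛ ((γ *ₛ φ ^ₛ suc m) *ₛ w ^ₛ i))
      ≡⟨ [x^ suc m ⊖ k ]-cong (x∙yz≈y∙xz w (γ *ₛ φ ^ₛ suc m) (w ^ₛ i)) ⟩
    [x^ suc m ⊖ k ] ((γ *ₛ φ ^ₛ suc m) *ₛ w ^ₛ suc i) ∎
    where
    open ≡-Reasoning
    m = i ℕ.+ j
    absorb : tail w *ₛ ((γ *ₛ φ ^ₛ suc m) *ₛ w ^ₛ i) ≗ (γ *ₛ φ ^ₛ m) *ₛ w ^ₛ i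
    absorb = R.begin
      u *ₛ ((γ *ₛ (φ *ₛ p)) *ₛ w ^ₛ i)   R.≈⟨ *ₛ-assoc u (γ *ₛ (φ *ₛ p)) (w ^ₛ i) ⟨
      (u *ₛ (γ *ₛ (φ *ₛ p))) *ₛ w ^ₛ i   R.≈⟨ *ₛ-congʳ (w ^ₛ i) (*ₛ-congˡ u (x∙yz≈y∙xz γ φ p)) ⟩
      (u *ₛ (φ *ₛ (γ *ₛ p))) *ₛ w ^ₛ i   R.≈⟨ *ₛ-congʳ (w ^ₛ i) (x∙yz≈y∙xz u φ (γ *ₛ p)) ⟩
      (φ *ₛ (u *ₛ (γ *ₛ p))) *ₛ w ^ₛ i   R.≈⟨ *ₛ-congʳ (w ^ₛ i) (*ₛ-assoc φ u (γ *ₛ p)) ⟨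
      ((φ *ₛ u) *ₛ (γ *ₛ p)) *ₛ w ^ₛ i   R.≈⟨ *ₛ-congʳ (w ^ₛ i) (*ₛ-congʳ (γ *ₛ p) φu≗1) ⟩
      (1ₛ *ₛ (γ *ₛ p)) *ₛ w ^ₛ i         R.≈⟨ *ₛ-congʳ (w ^ₛ i) (1ₛ-*ₛ (γ *ₛ p)) ⟩
      (γ *ₛ p) *ₛ w ^ₛ i                 R.∎
      where
      module R = ≗-Reasoning
      u = tail w
      p = φ ^ₛ m

-- Composing v = x · `tail v` with w gives x = w · (`tail v` ∘ w), and f ∘ w is the reciprocal of
-- the last factor; hence w = x · (f ∘ w).
∘ₛ-reciprocal-tail : ∀ v w → v 0 ≡ 0ℚ → w 0 ≡ 0ℚ → v ∘ₛ w ≗ X →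
                     ∀ f → f *ₛ tail v ≗ 1ₛ → f ∘ₛ w ≗ tail w
∘ₛ-reciprocal-tail v w v₀≡0 w₀≡0 v∘w≗X f fu≗1 n =
  -- The factor x is cancelled by comparing coefficients of degree n + 1.
  trans (sym (tail-X*ₛ (f ∘ₛ w) n)) (sym (w≗X*f∘w (suc n)))
  where
  open ≗-Reasoning
  u = tail v
  w≗X*f∘w : w ≗ X *ₛ (f ∘ₛ w)
  w≗X*f∘w = begin
    w                                      ≈⟨ *ₛ-1ₛ w ⟨
    w *ₛ 1ₛ                                ≈⟨ *ₛ-congˡ w (∘ₛ-inverse w w₀≡0 f u fu≗1) ⟨
    w *ₛ ((f ∘ₛ w) *ₛ (u ∘ₛ w))            ≈⟨ x∙yz≈y∙xz w (f ∘ₛ w) (u ∘ₛ w) ⟩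
    (f ∘ₛ w) *ₛ (w *ₛ (u ∘ₛ w))            ≈⟨ *ₛ-congˡ (f ∘ₛ w) (*ₛ-congʳ (u ∘ₛ w) (X-∘ₛ w w₀≡0)) ⟨
    (f ∘ₛ w) *ₛ ((X ∘ₛ w) *ₛ (u ∘ₛ w))     ≈⟨ *ₛ-congˡ (f ∘ₛ w) (∘ₛ-*ₛ w w₀≡0 X u) ⟨
    (f ∘ₛ w) *ₛ ((X *ₛ u) ∘ₛ w)            ≈⟨ *ₛ-congˡ (f ∘ₛ w) (∘ₛ-congˡ w (X*ₛtail v v₀≡0)) ⟨
    (f ∘ₛ w) *ₛ (v ∘ₛ w)                   ≈⟨ *ₛ-congˡ (f ∘ₛ w) v∘w≗X ⟩
    (f ∘ₛ w) *ₛ X                          ≈⟨ *ₛ-comm (f ∘ₛ w) X ⟩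
    X *ₛ (f ∘ₛ w)                          ∎

-- Phrased through relations between the data instead of `Rev`, so that both orders of the product
-- are instances.
mulEntry-identity : ∀ g f γ φ w → w 0 ≡ 0ℚ →
                    ⌊ f ⌋₀ ∘ₛ w ≗ tail w → ⌊ φ ⌋₀ *ₛ tail w ≗ 1ₛ → ⌊ γ ⌋₀ *ₛ (⌊ g ⌋₀ ∘ₛ w) ≗ 1ₛ →
                    ∀ n k → mulEntry ⟪ g , f ⟫ ⟪ γ , φ ⟫ n k ≡ identityEntry n k
mulEntry-identity g′ f′ γ′ φ′ w w₀≡0 f∘w≗u φu≗1 γg∘w≗1 n k = begin
  ∑[ j ≤ n ] ([x^ n ⊖ toℕ j ] c * entry B (toℕ j) k)
    -- With j = n - i, the left factor becomes the coefficient of xⁱ in g fⁿ, and the right one is i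
    -- rows short of row n, as `[x^]-shift` requires.
    ≡⟨ sum-reverse n (λ j → [x^ n ⊖ j ] c * entry B j k) ⟩
  ∑[ i ≤ n ] ([x^ n ⊖ (n ∸ toℕ i) ] c * entry B (n ∸ toℕ i) k)
    ≡⟨ sum-cong-≗ {suc n} (λ i → cong₂ _*_ (left (Fin.toℕ≤pred[n] i)) (right (Fin.toℕ≤pred[n] i))) ⟩
  ∑[ i ≤ n ] (c (toℕ i) * [x^ n ⊖ k ] ((γ *ₛ φ ^ₛ n) *ₛ w ^ₛ toℕ i))
    ≡⟨ [x^]-*ₛ-∘ₛ w w₀≡0 n k (γ *ₛ φ ^ₛ n) c ⟩
  [x^ n ⊖ k ] ((γ *ₛ φ ^ₛ n) *ₛ (c ∘ₛ w))
    ≡⟨ [x^ n ⊖ k ]-cong collapse ⟩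
  [x^ n ⊖ k ] 1ₛ
    ≡⟨ [x^n⊖k]1ₛ n k ⟩
  identityEntry n k ∎
  where
  open ≡-Reasoning
  g = ⌊ g′ ⌋₀
  f = ⌊ f′ ⌋₀
  γ = ⌊ γ′ ⌋₀
  φ = ⌊ φ′ ⌋₀
  B = ⟪ γ′ , φ′ ⟫
  c = g *ₛ f ^ₛ n

  left : ∀ {i} → i ≤ n → [x^ n ⊖ (n ∸ i) ] c ≡ c i
  left {i} i≤n = cong ([x^_] c)
    (trans (ℤ.⊖-≥ (ℕ.m∸n≤m n i)) (cong pos (ℕ.m∸[m∸n]≡n i≤n)))

  right : ∀ {i} → i ≤ n → entry B (n ∸ i) k ≡ [x^ n ⊖ k ] ((γ *ₛ φ ^ₛ n) *ₛ w ^ₛ i)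
  right {i} i≤n = trans ([x^]-shift w w₀≡0 γ φ φu≗1 i (n ∸ i) k)
    (cong (λ m → [x^ m ⊖ k ] ((γ *ₛ φ ^ₛ m) *ₛ w ^ₛ i)) (ℕ.m+[n∸m]≡n i≤n))

  -- γ cancels g ∘ w, and φⁿ cancels (f ∘ w)ⁿ = (`tail w`)ⁿ.
  collapse : (γ *ₛ φ ^ₛ n) *ₛ (c ∘ₛ w) ≗ 1ₛ
  collapse = R.begin
    (γ *ₛ φ ^ₛ n) *ₛ (c ∘ₛ w)
      R.≈⟨ *ₛ-congˡ (γ *ₛ φ ^ₛ n) (∘ₛ-*ₛ w w₀≡0 g (f ^ₛ n)) ⟩
    (γ *ₛ φ ^ₛ n) *ₛ ((g ∘ₛ w) *ₛ ((f ^ₛ n) ∘ₛ w))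
      R.≈⟨ interchange γ (φ ^ₛ n) (g ∘ₛ w) ((f ^ₛ n) ∘ₛ w) ⟩
    (γ *ₛ (g ∘ₛ w)) *ₛ (φ ^ₛ n *ₛ ((f ^ₛ n) ∘ₛ w))
      R.≈⟨ *ₛ-cong γg∘w≗1 (*ₛ-congˡ (φ ^ₛ n) (≗-trans (∘ₛ-^ₛ w w₀≡0 f n) (^ₛ-cong f∘w≗u n))) ⟩
    1ₛ *ₛ (φ ^ₛ n *ₛ tail w ^ₛ n)
      R.≈⟨ 1ₛ-*ₛ (φ ^ₛ n *ₛ tail w ^ₛ n) ⟩
    φ ^ₛ n *ₛ tail w ^ₛ n
      R.≈⟨ ^ₛ-distrib-*ₛ φ (tail w) n ⟨
    (φ *ₛ tail w) ^ₛ n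
      R.≈⟨ ^ₛ-cong φu≗1 n ⟩
    1ₛ ^ₛ n
      R.≈⟨ 1ₛ-^ₛ n ⟩
    1ₛ R.∎
    where module R = ≗-Reasoning

-- Reciprocals and the two orders of the product.

1/₀-inverseˡ : ∀ a → ⌊ 1/₀ a ⌋₀ *ₛ ⌊ a ⌋₀ ≗ 1ₛ
1/₀-inverseˡ (mk𝓕₀ a a₀≢0) = recipₛ-inverseˡ a a₀≢0

X/₁-inverseˡ : ∀ w → ⌊ X/₁ w ⌋₀ *ₛ tail ⌊ w ⌋₁ ≗ 1ₛ
X/₁-inverseˡ (mk𝓕₁ w _ w₁≢0) = recipₛ-inverseˡ (tail w) w₁≢0

X/₀-inverse : ∀ f → ⌊ f ⌋₀ *ₛ tail ⌊ X/₀ f ⌋₁ ≗ 1ₛ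
X/₀-inverse f = ≗-trans (*ₛ-congˡ ⌊ f ⌋₀ (tail-X*ₛ ⌊ 1/₀ f ⌋₀))
  (≗-trans (*ₛ-comm ⌊ f ⌋₀ ⌊ 1/₀ f ⌋₀) (1/₀-inverseˡ f))

corollary20 : (g f : 𝓕₀) →
    IsInverse ⟪ g , f ⟫ ⟪ 1/₀ (g ⟨ Rev (X/₀ f) ⟩) , X/₁ (Rev (X/₀ f)) ⟫
corollary20 g f =
    mulEntry-identity g f γ φ w w₀≡0
      (∘ₛ-reciprocal-tail v w v₀≡0 w₀≡0 (Rev-inverseʳ (X/₀ f)) ⌊ f ⌋₀ (X/₀-inverse f))
      (X/₁-inverseˡ w′) γg∘w≗1
  -- Here v = x/f replaces w, and (γ, φ) trades places with (g, f); now w ∘ v = x yields φ ∘ v =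
  -- `tail v`.
  , mulEntry-identity γ φ g f v v₀≡0
      (∘ₛ-reciprocal-tail w v w₀≡0 v₀≡0 (Rev-inverseˡ (X/₀ f)) ⌊ φ ⌋₀ (X/₁-inverseˡ w′))
      (X/₀-inverse f) gγ∘v≗1
  where
  w′ = Rev (X/₀ f)
  γ = 1/₀ (g ⟨ w′ ⟩)
  φ = X/₁ w′
  v = ⌊ X/₀ f ⌋₁
  w = ⌊ w′ ⌋₁
  v₀≡0 = 𝓕₁.c₀≡0 (X/₀ f)
  w₀≡0 = 𝓕₁.c₀≡0 w′

  γg∘w≗1 : ⌊ γ ⌋₀ *ₛ (⌊ g ⌋₀ ∘ₛ w) ≗ 1ₛ
  γg∘w≗1 = 1/₀-inverseˡ (g ⟨ w′ ⟩)

  g∘w∘v≗g : (⌊ g ⌋₀ ∘ₛ w) ∘ₛ v ≗ ⌊ g ⌋₀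
  g∘w∘v≗g = begin
    (⌊ g ⌋₀ ∘ₛ w) ∘ₛ v  ≈⟨ ∘ₛ-assoc w v w₀≡0 v₀≡0 ⌊ g ⌋₀ ⟩
    ⌊ g ⌋₀ ∘ₛ (w ∘ₛ v)  ≈⟨ ∘ₛ-congʳ ⌊ g ⌋₀ (Rev-inverseˡ (X/₀ f)) ⟩
    ⌊ g ⌋₀ ∘ₛ X         ≈⟨ ∘ₛ-X ⌊ g ⌋₀ ⟩
    ⌊ g ⌋₀              ∎
    where open ≗-Reasoning

  -- This is γ · (g ∘ w) = 1 composed with v, which undoes w.
  gγ∘v≗1 : ⌊ g ⌋₀ *ₛ (⌊ γ ⌋₀ ∘ₛ v) ≗ 1ₛ
  gγ∘v≗1 = begin
    ⌊ g ⌋₀ *ₛ (⌊ γ ⌋₀ ∘ₛ v)                 ≈⟨ *ₛ-congʳ (⌊ γ ⌋₀ ∘ₛ v) g∘w∘v≗g ⟨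
    ((⌊ g ⌋₀ ∘ₛ w) ∘ₛ v) *ₛ (⌊ γ ⌋₀ ∘ₛ v)   ≈⟨ *ₛ-comm ((⌊ g ⌋₀ ∘ₛ w) ∘ₛ v) (⌊ γ ⌋₀ ∘ₛ v) ⟩
    (⌊ γ ⌋₀ ∘ₛ v) *ₛ ((⌊ g ⌋₀ ∘ₛ w) ∘ₛ v)   ≈⟨ ∘ₛ-inverse v v₀≡0 ⌊ γ ⌋₀ (⌊ g ⌋₀ ∘ₛ w) γg∘w≗1 ⟩
    1ₛ                                      ∎
    where open ≗-Reasoning
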